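{- The number of permutations of cycle type $\alpha=(1^{m_1}2^{m_2}\ldots)$ is in $\#\mathsf{L}$, as the function $$(1^{m_1}\,0\,1^{m_2}\,0\,\dots)\ \mapsto\ \frac{n!}{z_\alpha}.$$
   Context: For $\alpha=(1^{m_1}2^{m_2}\dots)$, the partition with $m_i\ge 0$ parts equal to $i$, put $n=\sum_i i\,m_i$ and $z_\alpha=\prod_i i^{m_i}m_i!$; then $n!/z_\alpha$ is the number of permutations in $S_n$ having exactly $m_i$ cycles of length $i$ for every $i$. The alphabet is $\Sigma=\{0,1\}$; in the input string $1^{m_i}$ denotes a string of $m_i$ ones, and juxtaposition is concatenation. A function given only on strings of a specified form is extended by $0$ to all other strings. $\#\mathsf{L}$ is the class of functions $f:\Sigma^*\to\mathbb{N}_0$ such that $f(x)$ is the number of accepting computation paths on input $x$ of a fixed nondeterministic Turing machine with read-only input tape that uses $O(\log|x|)$ work space and halts on every computation path. Equivalently: there are a polynomial $q$ and a deterministic $O(\log|x|)$-space Turing machine $M$ with an additional read-once, left-to-right witness tape such that $f(x)=\#\{w\in\Sigma^{q(|x|)}\mid M(x,w)=\mathsf{yes}\}$. -}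

module Defs where

open import Data.Bool using (Bool; true; false; T)
open import Data.Fin using (Fin)
open import Data.List using (List; []; _∷_; _++_; length; replicate)
open import Data.List.Membership.Propositional using (_∈_)
open import Data.List.Relation.Unary.Unique.Propositional using (Unique)
open import Data.Maybe using (Maybe; just; nothing; maybe′)
import Data.Maybe as Maybe
open import Data.Nat using (ℕ; zero; suc; pred; _+_; _*_; _^_; _!; _/_; _⊓_; _≤_; NonZero)
open import Data.Nat.Logarithm using (⌊log₂_⌋)
open import Data.Nat.Properties using (m^n≢0; m*n≢0; _!≢0)
open import Data.Product using (Σ-syntax; ∃-syntax; _×_; _,_)
open import Data.Vec using (Vec)
import Data.Vec as Vec
open import Function using (flip; _↔_)
open import Induction.WellFounded using (Acc)
open import Relation.Binary.Construct.Closure.ReflexiveTransitive using (Star)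
open import Relation.Binary.PropositionalEquality using (_≡_; refl; cong)

-- Strings over Σ = {0,1}: false is the symbol 0, true is the symbol 1.
Str : Set
Str = List Bool

------------------------------------------------------------------------
-- Nondeterministic Turing machines with a read-only input tape

Finite : Set → Set
Finite A = ∃[ n ] (A ↔ Fin n)

data InputSymbol : Set where
  ⊢   : InputSymbol
  bit : Bool → InputSymbol
  ⊣   : InputSymbol

data Dir : Set where
  left stay right : Dir

record Move (State Γ : Set) (k : ℕ) : Set where
  constructor mkMove
  field
    target    : State
    inputDir  : Dir
    workMoves : Vec (Γ × Dir) k   -- symbol written and head direction, per work tape

record NTM : Set₁ where
  field
    State        : Set
    stateFinite  : Finite State
    Γ            : Set
    Γ-finite     : Finite Γ
    blank        : Γ
    tapes        : ℕ
    start        : State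
    accepting    : State → Bool
    δ            : State → InputSymbol → Vec Γ tapes → List (Move State Γ tapes)
    -- Each list of moves represents a set, so no move is counted twice.
    δ-unique     : ∀ q a g → Unique (δ q a g)

-- A two-way infinite work tape: `before` lists the cells to the left of the
-- head (nearest first), `after` those to its right (nearest first).  Exactly
-- the cells visited so far are stored; all other cells are blank.  Stored
-- cells are never discarded, even when they are blank.
record Tape (Γ : Set) : Set where
  constructor tape
  field
    before : List Γ
    head   : Γ
    after  : List Γ

cells : ∀ {Γ} → Tape Γ → ℕ
cells (tape ls _ rs) = length ls + 1 + length rs

writeMove : ∀ {Γ} → Γ → Tape Γ → Γ × Dir → Tape Γ
writeMove b (tape []       _ rs) (s , left)  = tape [] b (s ∷ rs)
writeMove b (tape (l ∷ ls) _ rs) (s , left)  = tape ls l (s ∷ rs)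
writeMove b (tape ls       _ rs) (s , stay)  = tape ls s rs
writeMove b (tape ls _ [])       (s , right) = tape (s ∷ ls) b []
writeMove b (tape ls _ (r ∷ rs)) (s , right) = tape (s ∷ ls) r rs

-- Position 0 of the input tape holds ⊢, positions 1 … |x| hold x, and
-- position |x| + 1 holds ⊣.
readInput : Str → ℕ → InputSymbol
readInput x       zero          = ⊢
readInput []      (suc _)       = ⊣
readInput (a ∷ x) (suc zero)    = bit a
readInput (a ∷ x) (suc (suc i)) = readInput x (suc i)

-- The input head does not leave the area delimited by the end markers.
moveInput : Str → Dir → ℕ → ℕ
moveInput x left  i = pred i
moveInput x stay  i = i
moveInput x right i = suc i ⊓ suc (length x)

module Run (M : NTM) (x : Str) where
  open NTM M

  record Config : Set where
    constructor config
    field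
      state     : State
      inputPos  : ℕ
      workTapes : Vec (Tape Γ) tapes

  open Config public

  initial : Config
  initial = config start 0 (Vec.replicate tapes (tape [] blank []))

  moves : Config → List (Move State Γ tapes)
  moves (config q i ts) = δ q (readInput x i) (Vec.map Tape.head ts)

  apply : Move State Γ tapes → Config → Config
  apply (mkMove q d ws) (config _ i ts) =
    config q (moveInput x d i) (Vec.zipWith (writeMove blank) ts ws)

  _⟶_ : Config → Config → Set
  c ⟶ d = ∃[ m ] (m ∈ moves c × d ≡ apply m c)

  Reachable : Config → Set
  Reachable = Star _⟶_ initial

  -- There is no infinite computation path.
  HaltsOnEveryPath : Set
  HaltsOnEveryPath = Acc (flip _⟶_) initial

  space : Config → ℕ
  space c = Vec.sum (Vec.map cells (workTapes c))

  -- A path is the sequence of moves taken.  It ends in a configuration that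
  -- has no applicable move, and it accepts if the state is then accepting.
  data AcceptingPathFrom (c : Config) : Set where
    halt : moves c ≡ [] → T (accepting (state c)) → AcceptingPathFrom c
    step : ∀ m → m ∈ moves c → AcceptingPathFrom (apply m c) → AcceptingPathFrom c

  AcceptingPath : Set
  AcceptingPath = AcceptingPathFrom initial

-- For |x| ≥ 2 the bound C * (1 + ⌊log₂ |x|⌋) is O(log |x|); the summand 1
-- only matters for |x| ≤ 1, where log |x| is undefined or 0.
LogSpace : NTM → Set
LogSpace M = ∃[ C ] ∀ x (c : Run.Config M x) → Run.Reachable M x c →
             Run.space M x c ≤ C * suc ⌊log₂ length x ⌋

_∈#L : (Str → ℕ) → Set₁
f ∈#L = Σ[ M ∈ NTM ]
          ( LogSpace M
          × (∀ x → Run.HaltsOnEveryPath M x)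
          × (∀ x → Run.AcceptingPath M x ↔ Fin (f x)))

------------------------------------------------------------------------
-- Cycle types

-- The list m₁ ∷ m₂ ∷ … ∷ m_k ∷ [] is the partition (1^m₁ 2^m₂ … k^m_k).
CycleType : Set
CycleType = List ℕ

-- In the two functions below the first entry of the list is the
-- multiplicity of the part suc i.
sizeFrom : ℕ → CycleType → ℕ
sizeFrom i []       = 0
sizeFrom i (m ∷ ms) = suc i * m + sizeFrom (suc i) ms

zFrom : ℕ → CycleType → ℕ
zFrom i []       = 1
zFrom i (m ∷ ms) = (suc i ^ m * m !) * zFrom (suc i) ms

size : CycleType → ℕ
size = sizeFrom 0

z : CycleType → ℕ
z = zFrom 0

zFrom≢0 : ∀ i α → NonZero (zFrom i α)
zFrom≢0 i []       = _
zFrom≢0 i (m ∷ ms) =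
  m*n≢0 (suc i ^ m * m !) (zFrom (suc i) ms)
    {{m*n≢0 (suc i ^ m) (m !) {{m^n≢0 (suc i) m}} {{m !≢0}}}}
    {{zFrom≢0 (suc i) ms}}

-- n! / z_α.  The division is exact, so rounding down plays no role.
cycleTypeCount : CycleType → ℕ
cycleTypeCount α = _/_ (size α !) (z α) {{zFrom≢0 0 α}}

-- 1^m₁ 0 1^m₂ 0 … 1^m_k 0, every block being closed by a 0.
encode : CycleType → Str
encode []       = []
encode (m ∷ ms) = replicate m true ++ false ∷ encode ms

incrementFirst : CycleType → Maybe CycleType
incrementFirst []       = nothing
incrementFirst (m ∷ ms) = just (suc m ∷ ms)

decode : Str → Maybe CycleType
decode []          = just []
decode (false ∷ x) = Maybe.map (0 ∷_) (decode x)
decode (true  ∷ x) = decode x Maybe.>>= incrementFirst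

-- decode is the partial inverse of encode: a string of the form encode α
-- decodes to α, and every other string decodes to nothing.
decode-encode : ∀ α → decode (encode α) ≡ just α
decode-encode []           = refl
decode-encode (zero ∷ ms)  rewrite decode-encode ms = refl
decode-encode (suc m ∷ ms) rewrite decode-encode (m ∷ ms) = refl

encode-decode : ∀ x {α} → decode x ≡ just α → encode α ≡ x
encode-decode []          refl = refl
encode-decode (false ∷ x) eq with decode x in h
encode-decode (false ∷ x) refl | just α = cong (false ∷_) (encode-decode x h)
encode-decode (true ∷ x)  eq with decode x in h
encode-decode (true ∷ x)  refl | just (m ∷ ms) = cong (true ∷_) (encode-decode x h)

cycleTypeFunction : Str → ℕ
cycleTypeFunction x = maybe′ cycleTypeCount 0 (decode x)

{-# OPTIONS --safe #-}
module Submission where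

-- The number n! / z is a product of integers, two for each part size i.  Let m
-- be the number of parts of size i, and N the total size of all smaller parts.
-- There are (N + im) C (im) ways to choose which of the first N + im elements lie
-- in parts of size i, and (im)! / (i ^ m * m !) permutations of these elements
-- with all cycles of length i.  The latter number is the product of all b with
-- 0 < b < im that are not divisible by i, since the product of i, 2i, ..., mi is
-- i ^ m * m !.
--
-- A machine with six counters produces this number as a number of paths.  For
-- each symbol 1 of the block it inserts i elements.  Before each insertion it
-- moves nondeterministically past some of the N old elements, which yields the
-- binomial coefficient by Pascal's rule (merge-accepts); and unless the element
-- is the first one of its part it guesses one of b values, where b is the number
-- of elements inserted before in the block (guess-accepts).  Hence, with y the
-- unread input and r old elements not yet passed, the number of accepting paths
-- is a weight times a binomial coefficient (input-accepts).  At the start of the input it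
-- is n! / z for an encoding, by weight-ones and blockPaths-encode, and 0 for
-- any other string, by weight-undecodable.
--
-- Counters are at most (|x| + 1)², so in binary each takes O(log |x|) cells of
-- its own work tape.  The module Compile turns any counter machine into a Turing
-- machine in which an increment, a decrement and a test for zero are
-- deterministic, so that the number of paths does not change.  The type Tree
-- collects what is needed of the computations from a configuration: they
-- are finite, stay within a space bound, and have a given number of accepting
-- paths.

open import Axiom.UniquenessOfIdentityProofs.WithK using (uip)
open import Data.Bool using (Bool; true; false; T; if_then_else_)
open import Data.Bool.Properties using (T-irrelevant)
open import Data.Fin using (Fin; #_)
import Data.Fin as Fin
open import Data.Fin.Patterns using (0F; 1F; 2F; 3F)
import Data.Fin.Properties as Fin
open import Data.List using (List; []; _∷_; [_]; length; _++_; replicate)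
open import Data.List.Membership.Propositional using (_∈_)
open import Data.List.Membership.Propositional.Properties.Core using (Any↔)
open import Data.List.Properties using (++-assoc; length-++)
open import Data.List.Relation.Unary.All using ([]; _∷_)
open import Data.List.Relation.Unary.AllPairs using ([]; _∷_)
open import Data.List.Relation.Unary.Any using (Any; here; there)
open import Data.List.Relation.Unary.Any.Properties using (∷↔; ⊥↔Any[])
open import Data.List.Relation.Unary.Unique.Propositional using (Unique)
open import Data.Maybe using (Maybe; just; nothing)
open import Data.Nat
open import Data.Nat.Combinatorics using
  (_C_; nCn≡1; nCk+nC[k+1]≡[n+1]C[k+1]; nCk≡n!/k![n-k]!; k![n∸k]!∣n!)
open import Data.Nat.DivMod using (m/n*n≡m; m*n/n≡m; /-congˡ)
open import Data.Nat.Logarithm using (⌊log₂_⌋; ⌊log₂⌋-mono-≤; ⌊log₂[2^n]⌋≡n)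
open import Data.Nat.Properties
open import Data.Nat.Tactic.RingSolver using (solve-∀)
open import Data.Product using (_×_; _,_; ∃-syntax; proj₁; proj₂)
open import Data.Product.Function.NonDependent.Propositional using (_×-↔_)
open import Data.Sum.Function.Propositional using (_⊎-↔_)
open import Data.Vec using (Vec; []; _∷_; lookup; _[_]≔_)
import Data.Vec as Vec
import Data.Vec.Properties as Vec
open import Function using (_↔_; mk↔ₛ′; flip; _∘_)
open import Function.Properties.Inverse using (↔-refl; ↔-sym; ↔-trans)
open import Induction.WellFounded using (Acc; acc)
open import Relation.Binary.Construct.Closure.ReflexiveTransitive using (Star; ε; _◅_)
open import Relation.Binary.PropositionalEquality hiding ([_])
open import Relation.Nullary using (yes; no)

open import Defs

-- Computation trees

module Computation (M : NTM) (x : Str) where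
  open NTM M
  open Run M x

  -- Tree S c n: the tree of all computations from c is finite, has n
  -- accepting leaves, and uses space at most S at every node.  Forest S c ms n
  -- is the same for the list of subtrees reached by the moves ms.
  data Tree (S : ℕ) (c : Config) : ℕ → Set
  data Forest (S : ℕ) (c : Config) : List (Move State Γ tapes) → ℕ → Set

  data Tree S c where
    leaf : space c ≤ S → moves c ≡ [] →
           Tree S c (if accepting (state c) then 1 else 0)
    node : ∀ {m ms n} → space c ≤ S → moves c ≡ m ∷ ms →
           Forest S c (m ∷ ms) n → Tree S c n

  data Forest S c where
    []  : Forest S c [] 0
    _∷_ : ∀ {m ms n k} → Tree S (apply m c) n → Forest S c ms k →
          Forest S c (m ∷ ms) (n + k)

  node₁ : ∀ {S c m n} → space c ≤ S → moves c ≡ [ m ] →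
          Tree S (apply m c) n → Tree S c n
  node₁ {S} {c} s e t =
    subst (Tree S c) (+-identityʳ _) (node s e (t ∷ []))

  node₂ : ∀ {S c m m′ n n′} → space c ≤ S → moves c ≡ m ∷ m′ ∷ [] →
          Tree S (apply m c) n → Tree S (apply m′ c) n′ → Tree S c (n + n′)
  node₂ {S} {c} {n = n} s e t t′ =
    subst (λ k → Tree S c (n + k)) (+-identityʳ _) (node s e (t ∷ t′ ∷ []))

  tree-halts   : ∀ {S c n} → Tree S c n → Acc (flip _⟶_) c
  forest-halts : ∀ {S c ms n} → Forest S c ms n →
                 ∀ {m} → m ∈ ms → Acc (flip _⟶_) (apply m c)
  tree-halts (leaf s e) =
    acc λ { (m , m∈ , refl) → case-[] (subst (m ∈_) e m∈) }
    where
    case-[] : ∀ {A : Set} {m : Move State Γ tapes} → m ∈ [] → A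
    case-[] ()
  tree-halts (node s e ts) =
    acc λ { (m , m∈ , refl) → forest-halts ts (subst (m ∈_) e m∈) }
  forest-halts (t ∷ ts) (here refl) = tree-halts t
  forest-halts (t ∷ ts) (there m∈)  = forest-halts ts m∈

  tree-root : ∀ {S c n} → Tree S c n → space c ≤ S
  tree-root (leaf s _)   = s
  tree-root (node s _ _) = s

  tree-space   : ∀ {S c n d} → Tree S c n → Star _⟶_ c d → space d ≤ S
  forest-space : ∀ {S c ms n d m} → Forest S c ms n → m ∈ ms →
                 Star _⟶_ (apply m c) d → space d ≤ S
  tree-space t ε = tree-root t
  tree-space (leaf s e) ((m , m∈ , refl) ◅ ss) with subst (m ∈_) e m∈
  ... | ()
  tree-space (node s e ts) ((m , m∈ , refl) ◅ ss) =
    forest-space ts (subst (m ∈_) e m∈) ss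
  forest-space (t ∷ ts) (here refl) ss = tree-space t ss
  forest-space (t ∷ ts) (there m∈)  ss = forest-space ts m∈ ss

  leaf-paths : ∀ {c} → moves c ≡ [] →
               AcceptingPathFrom c ↔ Fin (if accepting (state c) then 1 else 0)
  leaf-paths {c} e with accepting (state c) in eq
  ... | true  = mk↔ₛ′ (λ _ → Fin.zero) (λ _ → halt e (subst T (sym eq) _))
                  (λ { Fin.zero → refl ; (Fin.suc ()) }) unique
    where
    unique : ∀ p → halt e (subst T (sym eq) _) ≡ p
    unique (halt e′ a)   = cong₂ halt (uip e e′) (T-irrelevant _ a)
    unique (step m m∈ _) with subst (m ∈_) e m∈
    ... | ()
  ... | false = mk↔ₛ′ to (λ ()) (λ ()) (λ p → contra (to p))
    where
    to : AcceptingPathFrom c → Fin 0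
    to (halt _ a) with subst T eq a
    ... | ()
    to (step m m∈ _) with subst (m ∈_) e m∈
    ... | ()
    contra : ∀ {A : Set} → Fin 0 → A
    contra ()

  step-paths : ∀ {c m ms} → moves c ≡ m ∷ ms →
               AcceptingPathFrom c ↔
               (∃[ m ] (m ∈ moves c × AcceptingPathFrom (apply m c)))
  step-paths {c} e = mk↔ₛ′ to from (λ _ → refl) from-to
    where
    to : AcceptingPathFrom c → ∃[ m ] (m ∈ moves c × AcceptingPathFrom (apply m c))
    to (halt e′ _) with trans (sym e) e′
    ... | ()
    to (step m m∈ p) = m , m∈ , p
    from : (∃[ m ] (m ∈ moves c × AcceptingPathFrom (apply m c))) → AcceptingPathFrom c
    from (m , m∈ , p) = step m m∈ p
    from-to : ∀ p → from (to p) ≡ p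
    from-to (halt e′ _) with trans (sym e) e′
    ... | ()
    from-to (step m m∈ p) = refl

  tree-paths   : ∀ {S c n} → Tree S c n → AcceptingPathFrom c ↔ Fin n
  forest-paths : ∀ {S c ms n} → Forest S c ms n →
                 Any (λ m → AcceptingPathFrom (apply m c)) ms ↔ Fin n
  tree-paths (leaf s e)        = leaf-paths e
  tree-paths {c = c} (node {n = n} s e ts) =
    ↔-trans (step-paths e) (↔-trans Any↔
      (subst (λ ms → Any (λ m → AcceptingPathFrom (apply m c)) ms ↔ Fin n)
             (sym e) (forest-paths ts)))
  forest-paths []       = ↔-trans (↔-sym ⊥↔Any[]) (↔-sym Fin.0↔⊥)
  forest-paths (t ∷ ts) =
    ↔-trans (↔-sym (∷↔ _))
      (↔-trans (tree-paths t ⊎-↔ forest-paths ts) (↔-sym Fin.+↔⊎))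

-- Counter machines

-- Instructions of a machine with k counters and ℓ labels; the last labels of
-- an instruction say where to continue.
data Instruction (k ℓ : ℕ) : Set where
  inc    : Fin k → Fin ℓ → Instruction k ℓ
  -- Continues at the first label after decrementing a positive counter, and
  -- at the second one if the counter is zero.
  dec    : Fin k → Fin ℓ → Fin ℓ → Instruction k ℓ
  -- The labels must differ since a Turing machine has a set of moves.
  choose : (l l′ : Fin ℓ) → l ≢ l′ → Instruction k ℓ
  -- Reads an input symbol and moves the input head to the right.
  read   : (InputSymbol → Fin ℓ) → Instruction k ℓ
  stop   : Bool → Instruction k ℓ

data Symbol : Set where
  ␣ 𝟎 𝟏 : Symbol

symbol-finite : Finite Symbol
symbol-finite = 3 , mk↔ₛ′
  (λ { ␣ → 0F ; 𝟎 → 1F ; 𝟏 → 2F })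
  (λ { 0F → ␣ ; 1F → 𝟎 ; 2F → 𝟏 })
  (λ { 0F → refl ; 1F → refl ; 2F → refl })
  (λ { ␣ → refl ; 𝟎 → refl ; 𝟏 → refl })

-- A counter operation starts in the phase ready, propagates the carry to the
-- right in the phase scan, and returns to the left end of the numeral in the
-- phase back.  A decrement that finds the value zero returns in the phase undo.
data Phase : Set where
  ready scan back undo : Phase

phase-finite : Finite Phase
phase-finite = 4 , mk↔ₛ′
  (λ { ready → 0F ; scan → 1F ; back → 2F ; undo → 3F })
  (λ { 0F → ready ; 1F → scan ; 2F → back ; 3F → undo })
  (λ { 0F → refl ; 1F → refl ; 2F → refl ; 3F → refl })
  (λ { ready → refl ; scan → refl ; back → refl ; undo → refl })

-- Numeral W xs v: the cells xs hold v in binary, least significant digit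
-- first, with at most W digits.  Beyond the digits one blank cell may have been
-- visited.
data Numeral : ℕ → List Symbol → ℕ → Set where
  end   : ∀ {W} → Numeral W [] 0
  end␣  : ∀ {W} → Numeral W (␣ ∷ []) 0
  𝟎∷_   : ∀ {W xs v} → Numeral W xs v → Numeral (suc W) (𝟎 ∷ xs) (2 * v)
  𝟏∷_   : ∀ {W xs v} → Numeral W xs v → Numeral (suc W) (𝟏 ∷ xs) (suc (2 * v))

numeral-length : ∀ {W xs v} → Numeral W xs v → length xs ≤ suc W
numeral-length end    = z≤n
numeral-length end␣   = s≤s z≤n
numeral-length (𝟎∷ n) = s≤s (numeral-length n)
numeral-length (𝟏∷ n) = s≤s (numeral-length n)

-- What the carry of an increment makes of the digits.
increment : List Symbol → List Symbol
increment []       = 𝟏 ∷ []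
increment (␣ ∷ xs) = 𝟏 ∷ xs
increment (𝟎 ∷ xs) = 𝟏 ∷ xs
increment (𝟏 ∷ xs) = 𝟎 ∷ increment xs

2*suc : ∀ v → 2 * suc v ≡ suc (suc (2 * v))
2*suc v = *-suc 2 v

increment-numeral : ∀ {W xs v} → Numeral W xs v → suc v < 2 ^ W →
                    Numeral W (increment xs) (suc v)
increment-numeral {zero}  n    (s≤s ())
increment-numeral {suc W} end    _ = 𝟏∷ end
increment-numeral {suc W} end␣   _ = 𝟏∷ end
increment-numeral {suc W} (𝟎∷ n) _ = 𝟏∷ n
increment-numeral {suc W} (𝟏∷_ {v = v} n) v<2^W =
  subst (Numeral (suc W) _) (2*suc v) (𝟎∷ increment-numeral n (*-cancelˡ-< 2 _ _
    (subst (_< 2 ^ suc W) (sym (2*suc v)) v<2^W)))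

-- The cells to the left of the head, nearest first, when n digits have been
-- passed and each of them is now e.
stack : Symbol → ℕ → List Symbol
stack e zero    = ␣ ∷ []
stack e (suc n) = e ∷ stack e n

-- The tape with its head on a given list of cells, ls being the cells to the left.
focus : List Symbol → List Symbol → Tape Symbol
focus ls []       = tape ls ␣ []
focus ls (x ∷ xs) = tape ls x xs

-- The tape with its head just left of the cells xs, on the last of n digits e
-- or on the blank cell at the left end if n = 0.
beside : Symbol → ℕ → List Symbol → Tape Symbol
beside e zero    xs = tape [] ␣ xs
beside e (suc n) xs = tape (stack e n) e xs

-- n digits e followed by xs.
pad : Symbol → ℕ → List Symbol → List Symbol
pad e zero    xs = xs
pad e (suc n) xs = pad e n (e ∷ xs)

writeMove-left : ∀ e n {h rs} s →
  writeMove ␣ (tape (stack e n) h rs) (s , left) ≡ beside e n (s ∷ rs)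
writeMove-left e zero    s = refl
writeMove-left e (suc n) s = refl

writeMove-right : ∀ ls {h} xs s →
  writeMove ␣ (tape ls h xs) (s , right) ≡ focus (s ∷ ls) xs
writeMove-right []      []      s = refl
writeMove-right []      (_ ∷ _) s = refl
writeMove-right (_ ∷ _) []      s = refl
writeMove-right (_ ∷ _) (_ ∷ _) s = refl

cells-beside : ∀ e n xs → cells (beside e n xs) ≡ suc (n + length xs)
cells-beside e zero    xs = refl
cells-beside e (suc n) xs =
  trans (cong (_+ length xs) (+-comm (length (stack e n)) 1))
        (cong (λ m → suc (m + length xs)) (length-stack n))
  where
  length-stack : ∀ n → length (stack e n) ≡ suc n
  length-stack zero    = refl
  length-stack (suc n) = cong suc (length-stack n)

module Compile {k ℓ : ℕ} (program : Fin ℓ → Instruction k ℓ) (entry : Fin ℓ) where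

  Control : Set
  Control = Fin ℓ × Phase

  -- One step of a counter operation at label l: the next state, the symbol
  -- written on the tape of the counter, and the direction of its head.
  incStep : Fin ℓ → Fin ℓ → Phase → Symbol → Maybe (Control × (Symbol × Dir))
  incStep l next ready a = just ((l , scan) , (a , right))
  incStep l next scan  𝟏 = just ((l , scan) , (𝟎 , right))
  incStep l next scan  _ = just ((l , back) , (𝟏 , left))
  incStep l next back  ␣ = just ((next , ready) , (␣ , stay))
  incStep l next back  a = just ((l , back) , (a , left))
  incStep l next undo  _ = nothing

  decStep : Fin ℓ → Fin ℓ → Fin ℓ → Phase → Symbol → Maybe (Control × (Symbol × Dir))
  decStep l next empty ready a = just ((l , scan) , (a , right))
  decStep l next empty scan  𝟎 = just ((l , scan) , (𝟏 , right))
  decStep l next empty scan  𝟏 = just ((l , back) , (𝟎 , left))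
  decStep l next empty scan  ␣ = just ((l , undo) , (␣ , left))
  decStep l next empty back  ␣ = just ((next , ready) , (␣ , stay))
  decStep l next empty back  a = just ((l , back) , (a , left))
  decStep l next empty undo  ␣ = just ((empty , ready) , (␣ , stay))
  decStep l next empty undo  _ = just ((l , undo) , (𝟎 , left))

  keep : Vec Symbol k → Vec (Symbol × Dir) k
  keep = Vec.map (_, stay)

  onTape : Fin k → Vec Symbol k → Maybe (Control × (Symbol × Dir)) →
           List (Move Control Symbol k)
  onTape A g nothing        = []
  onTape A g (just (s , w)) = [ mkMove s stay (keep g [ A ]≔ w) ]

  transitions : Fin ℓ → Instruction k ℓ → Phase → InputSymbol → Vec Symbol k →
                List (Move Control Symbol k)
  transitions l (inc A next)       ph a g = onTape A g (incStep l next ph (lookup g A))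
  transitions l (dec A next empty) ph a g = onTape A g (decStep l next empty ph (lookup g A))
  transitions l (choose m m′ _) ready a g =
    mkMove (m , ready) stay (keep g) ∷ mkMove (m′ , ready) stay (keep g) ∷ []
  transitions l (read f)        ready a g = [ mkMove (f a , ready) right (keep g) ]
  transitions l _               _     a g = []

  onTape-unique : ∀ A g r → Unique (onTape A g r)
  onTape-unique A g nothing  = []
  onTape-unique A g (just _) = [] ∷ []

  transitions-unique : ∀ l i ph a g → Unique (transitions l i ph a g)
  transitions-unique l (inc A next)       ph a g = onTape-unique A g _
  transitions-unique l (dec A next empty) ph a g = onTape-unique A g _
  transitions-unique l (choose m m′ m≢m′) ready a g =
    ((λ e → m≢m′ (cong (proj₁ ∘ Move.target) e)) ∷ []) ∷ [] ∷ []
  transitions-unique l (choose m m′ _) scan a g = []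
  transitions-unique l (choose m m′ _) back a g = []
  transitions-unique l (choose m m′ _) undo a g = []
  transitions-unique l (read f) ready a g = [] ∷ []
  transitions-unique l (read f) scan  a g = []
  transitions-unique l (read f) back  a g = []
  transitions-unique l (read f) undo  a g = []
  transitions-unique l (stop _) ph    a g = []

  accepts : Instruction k ℓ → Bool
  accepts (stop b) = b
  accepts _        = false

  machine : NTM
  machine = record
    { State       = Control
    ; stateFinite = ℓ * proj₁ phase-finite ,
                    ↔-trans (↔-refl ×-↔ proj₂ phase-finite) (↔-sym Fin.*↔×)
    ; Γ           = Symbol
    ; Γ-finite    = symbol-finite
    ; blank       = ␣
    ; tapes       = k
    ; start       = entry , ready
    ; accepting   = λ (l , _) → accepts (program l)
    ; δ           = λ (l , ph) → transitions l (program l) ph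
    ; δ-unique    = λ (l , ph) → transitions-unique l (program l) ph
    }

  -- Writing on every tape the symbol that is read changes nothing.
  writeMove-keep : ∀ {m} (ts : Vec (Tape Symbol) m) →
    Vec.zipWith (writeMove ␣) ts (Vec.map (_, stay) (Vec.map Tape.head ts)) ≡ ts
  writeMove-keep []                      = refl
  writeMove-keep (tape []      _ _ ∷ ts) = cong (_ ∷_) (writeMove-keep ts)
  writeMove-keep (tape (_ ∷ _) _ _ ∷ ts) = cong (_ ∷_) (writeMove-keep ts)

  writeMove-one : ∀ {m} (ts : Vec (Tape Symbol) m) A w →
    Vec.zipWith (writeMove ␣) ts (Vec.map (_, stay) (Vec.map Tape.head ts) [ A ]≔ w) ≡
    ts [ A ]≔ writeMove ␣ (lookup ts A) w
  writeMove-one (t ∷ ts)                Fin.zero    w = cong (_ ∷_) (writeMove-keep ts)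
  writeMove-one (tape []      _ _ ∷ ts) (Fin.suc A) w = cong (_ ∷_) (writeMove-one ts A w)
  writeMove-one (tape (_ ∷ _) _ _ ∷ ts) (Fin.suc A) w = cong (_ ∷_) (writeMove-one ts A w)

  sum-cells : ∀ {m S} (ts : Vec (Tape Symbol) m) → (∀ i → cells (lookup ts i) ≤ S) →
              Vec.sum (Vec.map cells ts) ≤ m * S
  sum-cells []       _ = z≤n
  sum-cells (t ∷ ts) h = +-mono-≤ (h Fin.zero) (sum-cells ts (h ∘ Fin.suc))

  -- Runs on the input x in which no counter exceeds W binary digits.
  module Execution (W : ℕ) (x : Str) where
    open Computation machine x
    open Run machine x hiding (halt; step)

    -- The cells allowed on a tape: besides the digits there are the blank cell at
    -- the left end, where the head rests, and the blank cell reached when a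
    -- decrement fails.  The third extra cell makes the condition Fits below
    -- uniform: it holds even with an unvisited cell to the right of xs.
    width : ℕ
    width = 3 + W

    S : ℕ
    S = k * width

    -- The tape holds a value, and its head rests at the left end.
    data Counter : Tape Symbol → ℕ → Set where
      holds : ∀ {xs v} → Numeral W xs v → Counter (tape [] ␣ xs) v

    Counters : Vec (Tape Symbol) k → Vec ℕ k → Set
    Counters ts vs = ∀ i → Counter (lookup ts i) (lookup vs i)

    -- From label l with input position p and counter values vs, the machine
    -- has n accepting paths, within the space bound.
    record Accepts (l : Fin ℓ) (p : ℕ) (vs : Vec ℕ k) (n : ℕ) : Set where
      field
        computation : ∀ ts → Counters ts vs → Tree S (config (l , ready) p ts) n

    open Accepts

    counter-fits : ∀ {t v} → Counter t v → cells t ≤ width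
    counter-fits (holds n) = s≤s (≤-trans (numeral-length n) (m≤n+m _ 1))

    counters-space : ∀ s p ts vs → Counters ts vs → space (config s p ts) ≤ S
    counters-space s p ts vs cs = sum-cells ts (λ i → counter-fits (cs i))

    lookup-updated : ∀ {X Y : Set} (P : X → Y → Set) (ts : Vec X k) (vs : Vec Y k) {A t v} →
                     (∀ i → P (lookup ts i) (lookup vs i)) → P t v →
                     ∀ i → P (lookup (ts [ A ]≔ t) i) (lookup (vs [ A ]≔ v) i)
    lookup-updated P ts vs {A} {t} {v} h p i with i Fin.≟ A
    ... | yes refl =
      subst₂ P (sym (Vec.lookup∘update i ts t)) (sym (Vec.lookup∘update i vs v)) p
    ... | no i≢A   =
      subst₂ P (sym (Vec.lookup∘update′ i≢A ts t)) (sym (Vec.lookup∘update′ i≢A vs v)) (h i)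

    accepts-stop : ∀ {l p vs} b → program l ≡ stop b →
                   Accepts l p vs (if b then 1 else 0)
    accepts-stop {l} {p} {vs} b e .computation ts cs =
      subst (λ i → Tree S (config (l , ready) p ts) (if accepts i then 1 else 0)) e
        (leaf (counters-space (l , ready) p ts vs cs)
              (cong (λ i → transitions l i ready (readInput x p) (Vec.map Tape.head ts)) e))

    Tree-keep : ∀ {s p n} ts → Tree S (config s p ts) n →
                Tree S (config s p (Vec.zipWith (writeMove ␣) ts (keep (Vec.map Tape.head ts)))) n
    Tree-keep {s} {p} {n} ts = subst (λ ts → Tree S (config s p ts) n) (sym (writeMove-keep ts))

    accepts-choose : ∀ {l p vs m m′ n n′ d} → program l ≡ choose m m′ d →
      Accepts m p vs n → Accepts m′ p vs n′ → Accepts l p vs (n + n′)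
    accepts-choose {l} {p} {vs} e a a′ .computation ts cs =
      node₂ (counters-space (l , ready) p ts vs cs)
        (cong (λ i → transitions l i ready (readInput x p) (Vec.map Tape.head ts)) e)
        (Tree-keep ts (a .computation ts cs)) (Tree-keep ts (a′ .computation ts cs))

    accepts-read : ∀ {l p vs f n} → program l ≡ read f →
      Accepts (f (readInput x p)) (moveInput x right p) vs n → Accepts l p vs n
    accepts-read {l} {p} {vs} e a .computation ts cs =
      node₁ (counters-space (l , ready) p ts vs cs)
        (cong (λ i → transitions l i ready (readInput x p) (Vec.map Tape.head ts)) e)
        (Tree-keep ts (a .computation ts cs))

    -- A counter operation on the tape A, whose transitions are given by f,
    -- while the other tapes are those of ts.
    module Operation (l : Fin ℓ) (p : ℕ) (A : Fin k)
                     (f : Phase → Symbol → Maybe (Control × (Symbol × Dir)))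
                     (program-l : ∀ ph a g → transitions l (program l) ph a g ≡
                                             onTape A g (f ph (lookup g A)))
                     (ts : Vec (Tape Symbol) k)
                     (ts-fit : ∀ i → cells (lookup ts i) ≤ width) where

      -- The computation tree from state s with the tape t in place of tape A.
      At : Control → Tape Symbol → ℕ → Set
      At s t = Tree S (config s p (ts [ A ]≔ t))

      operate : ∀ {ph t s w n} → f ph (Tape.head t) ≡ just (s , w) → cells t ≤ width →
                At s (writeMove ␣ t w) n → At (l , ph) t n
      operate {ph} {t} {s} {w} {n} e fit a =
        node₁ (sum-cells (ts [ A ]≔ t)
                 (lookup-updated (λ t _ → cells t ≤ width) ts ts {v = t} ts-fit fit))
          (trans (program-l ph (readInput x p) heads)
            (trans (cong (λ a → onTape A heads (f ph a)) head-A) (cong (onTape A heads) e)))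
          (subst (λ ts → Tree S (config s p ts) n) (sym tapes-after) a)
        where
        heads = Vec.map Tape.head (ts [ A ]≔ t)
        head-A : lookup heads A ≡ Tape.head t
        head-A = trans (Vec.lookup-map A Tape.head (ts [ A ]≔ t))
                       (cong Tape.head (Vec.lookup∘update A ts t))
        tapes-after : Vec.zipWith (writeMove ␣) (ts [ A ]≔ t)
                        (keep heads [ A ]≔ w) ≡
                      ts [ A ]≔ writeMove ␣ t w
        tapes-after = begin
          _ ≡⟨ writeMove-one (ts [ A ]≔ t) A w ⟩
          ts [ A ]≔ t [ A ]≔ writeMove ␣ (lookup (ts [ A ]≔ t) A) w
            ≡⟨ Vec.[]≔-idempotent ts A ⟩
          ts [ A ]≔ writeMove ␣ (lookup (ts [ A ]≔ t) A) w
            ≡⟨ cong (λ t → ts [ A ]≔ writeMove ␣ t w) (Vec.lookup∘update A ts t) ⟩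
          ts [ A ]≔ writeMove ␣ t w ∎
          where open ≡-Reasoning

      -- The head returns to the left end, replacing each digit e by e′.
      rewind : ∀ {ph m e e′ N} → f ph e ≡ just ((l , ph) , (e′ , left)) →
               f ph ␣ ≡ just ((m , ready) , (␣ , stay)) →
               ∀ n xs → suc (n + length xs) ≤ width →
               At (m , ready) (tape [] ␣ (pad e′ n xs)) N →
               At (l , ph) (beside e n xs) N
      rewind fe f␣ zero    xs fit a = operate f␣ fit a
      rewind {ph} {e = e} {e′} fe f␣ (suc n) xs fit a =
        operate fe (subst (_≤ width) (sym (cells-beside e (suc n) xs)) fit)
          (subst (λ t → At _ t _) (sym (writeMove-left e n e′))
            (rewind fe f␣ n (e′ ∷ xs)
              (subst (_≤ width) (cong suc (sym (+-suc n (length xs)))) fit) a))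

      -- The head is on the first of the cells xs, after n digits e; there is
      -- room for one more step to the right.
      Fits : ℕ → List Symbol → Set
      Fits n xs = 2 + (n + length xs) ≤ width

      fits-suc : ∀ n x xs → Fits n (x ∷ xs) → Fits (suc n) xs
      fits-suc n x xs = subst (_≤ width) (cong (2 +_) (+-suc n (length xs)))

      cells-focus : ∀ e n xs → Fits n xs → cells (focus (stack e n) xs) ≤ width
      cells-focus e n []       fit =
        subst (_≤ width) (sym (cells-beside e (suc n) [])) fit
      cells-focus e n (x ∷ xs) fit =
        subst (_≤ width) (sym (cells-beside e (suc n) xs)) (≤-trans (n≤1+n _) (fits-suc n x xs fit))

      scan-right : ∀ {e e′ N} n xs → f scan e′ ≡ just ((l , scan) , (e , right)) →
                   Fits n (e′ ∷ xs) → At (l , scan) (focus (stack e (suc n)) xs) N →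
                   At (l , scan) (focus (stack e n) (e′ ∷ xs)) N
      scan-right {e} {e′} n xs fe fit a =
        operate fe (cells-focus e n (e′ ∷ xs) fit)
          (subst (λ t → At _ t _) (sym (writeMove-right (stack e n) xs e)) a)

      fits-tail : ∀ n x xs → Fits n (x ∷ xs) → Fits n xs
      fits-tail n x xs fit = ≤-trans (n≤1+n _) (fits-suc n x xs fit)

      -- The last step of the scan, followed by the return.
      turn : ∀ {e e′ s h ph m N} n xs → f scan h ≡ just ((l , ph) , (s , left)) →
             f ph e ≡ just ((l , ph) , (e′ , left)) →
             f ph ␣ ≡ just ((m , ready) , (␣ , stay)) → Fits n xs →
             At (m , ready) (tape [] ␣ (pad e′ n (s ∷ xs))) N →
             At (l , scan) (tape (stack e n) h xs) N
      turn {e} {s = s} n xs fh fe f␣ fit a =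
        operate fh (subst (_≤ width) (sym (cells-beside e (suc n) xs)) fit)
          (subst (λ t → At _ t _) (sym (writeMove-left e n s))
            (rewind fe f␣ n (s ∷ xs)
              (subst (_≤ width) (cong suc (sym (+-suc n (length xs)))) fit) a))

      start-scan : ∀ {N} xs → f ready ␣ ≡ just ((l , scan) , (␣ , right)) →
                   length xs ≤ suc W → At (l , scan) (focus (stack 𝟎 0) xs) N →
                   At (l , ready) (tape [] ␣ xs) N
      start-scan xs fr len a =
        operate fr (s≤s (≤-trans len (m≤n+m _ 1)))
          (subst (λ t → At _ t _) (sym (writeMove-right [] xs ␣)) a)

    accepts-inc : ∀ {l p A m vs n} → program l ≡ inc A m → suc (lookup vs A) < 2 ^ W →
      Accepts m p (vs [ A ]≔ suc (lookup vs A)) n → Accepts l p vs n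
    accepts-inc {l} {p} {A} {m} {vs} {n} e v<2^W a .computation ts cs =
      subst (λ ts → Tree S (config _ p ts) n) (Vec.[]≔-lookup ts A) (run (cs A))
      where
      open Operation l p A (incStep l m)
        (λ ph b g → cong (λ i → transitions l i ph b g) e) ts (λ i → counter-fits (cs i))

      carry : ∀ {N} n xs → Fits n xs → At (m , ready) (tape [] ␣ (pad 𝟎 n (increment xs))) N →
              At (l , scan) (focus (stack 𝟎 n) xs) N
      carry n []       fit a = turn n [] refl refl refl fit a
      carry n (␣ ∷ xs) fit a = turn n xs refl refl refl (fits-tail n ␣ xs fit) a
      carry n (𝟎 ∷ xs) fit a = turn n xs refl refl refl (fits-tail n 𝟎 xs fit) a
      carry n (𝟏 ∷ xs) fit a =
        scan-right n xs refl fit (carry (suc n) xs (fits-suc n 𝟏 xs fit) a)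

      run : ∀ {t} → Counter t (lookup vs A) → At (l , ready) t n
      run (holds {xs} num) = start-scan xs refl (numeral-length num)
        (carry 0 xs (s≤s (s≤s (numeral-length num)))
          (a .computation _ (lookup-updated Counter ts vs cs (holds (increment-numeral num v<2^W)))))

    accepts-dec : ∀ {l p A m z vs v n} → program l ≡ dec A m z → lookup vs A ≡ suc v →
      Accepts m p (vs [ A ]≔ v) n → Accepts l p vs n
    accepts-dec {l} {p} {A} {m} {z} {vs} {v} {n} e vA a .computation ts cs =
      subst (λ ts → Tree S (config _ p ts) n) (Vec.[]≔-lookup ts A) (run (cs A) vA)
      where
      open Operation l p A (decStep l m z)
        (λ ph b g → cong (λ i → transitions l i ph b g) e) ts (λ i → counter-fits (cs i))

      borrow : ∀ {V xs u v} → Numeral V xs u → u ≡ suc v → ∃[ ys ]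
        (Numeral V ys v ×
         (∀ {N} n → Fits n xs → At (m , ready) (tape [] ␣ (pad 𝟏 n ys)) N →
                    At (l , scan) (focus (stack 𝟏 n) xs) N))
      borrow (𝟏∷_ {xs = xs} num) refl = 𝟎 ∷ xs , (𝟎∷ num) ,
        λ n fit → turn n xs refl refl refl (fits-tail n 𝟏 xs fit)
      borrow (𝟎∷_ {xs = xs} {v = suc u} num) refl with borrow num refl
      ... | ys , num′ , below = 𝟏 ∷ ys ,
        subst (Numeral _ (𝟏 ∷ ys)) (sym (suc-injective (2*suc u))) (𝟏∷ num′) ,
        λ n fit a → scan-right n xs refl fit (below (suc n) (fits-suc n 𝟎 xs fit) a)

      run : ∀ {t u} → Counter t u → u ≡ suc v → At (l , ready) t n
      run (holds {xs} num) u≡1+v with borrow num u≡1+v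
      ... | ys , num′ , below = start-scan xs refl (numeral-length num)
        (below 0 (s≤s (s≤s (numeral-length num)))
          (a .computation _ (lookup-updated Counter ts vs cs (holds num′))))

    accepts-dec-zero : ∀ {l p A m z vs n} → program l ≡ dec A m z → lookup vs A ≡ 0 →
      Accepts z p vs n → Accepts l p vs n
    accepts-dec-zero {l} {p} {A} {m} {z} {vs} {n} e vA a .computation ts cs =
      subst (λ ts → Tree S (config _ p ts) n) (Vec.[]≔-lookup ts A) (run (cs A) vA)
      where
      open Operation l p A (decStep l m z)
        (λ ph b g → cong (λ i → transitions l i ph b g) e) ts (λ i → counter-fits (cs i))

      -- The digits are all zero; the cells may gain a visited blank cell.
      borrow : ∀ {V xs u} → Numeral V xs u → u ≡ 0 → ∃[ ys ]
        (Numeral V ys 0 ×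
         (∀ {N} n → Fits n xs → At (z , ready) (tape [] ␣ (pad 𝟎 n ys)) N →
                    At (l , scan) (focus (stack 𝟏 n) xs) N))
      borrow end  _ = ␣ ∷ [] , end␣ , λ n fit → turn n [] refl refl refl fit
      borrow end␣ _ = ␣ ∷ [] , end␣ , λ n fit → turn n [] refl refl refl (fits-tail n ␣ [] fit)
      borrow (𝟎∷_ {xs = xs} {v = zero} num) refl with borrow num refl
      ... | ys , num′ , below = 𝟎 ∷ ys , (𝟎∷ num′) ,
        λ n fit a → scan-right n xs refl fit (below (suc n) (fits-suc n 𝟎 xs fit) a)

      run : ∀ {t u} → Counter t u → u ≡ 0 → At (l , ready) t n
      run (holds {xs} num) u≡0 with borrow num u≡0
      ... | ys , num′ , below = start-scan xs refl (numeral-length num)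
        (below 0 (s≤s (s≤s (numeral-length num)))
          (a .computation _ (subst (Counters (ts [ A ]≔ tape [] ␣ ys)) vs-unchanged
                 (lookup-updated Counter ts vs cs (holds num′)))))
        where
        vs-unchanged : vs [ A ]≔ 0 ≡ vs
        vs-unchanged = trans (cong (vs [ A ]≔_) (sym vA)) (Vec.[]≔-lookup vs A)

    initial-counters : Counters (Vec.replicate k (tape [] ␣ [])) (Vec.replicate k 0)
    initial-counters i =
      subst₂ Counter (sym (Vec.lookup-replicate i _)) (sym (Vec.lookup-replicate i 0)) (holds end)

-- A counter machine for permutations of a given cycle type

-- The counters, for a block of parts of size i, when N elements lie in smaller
-- parts and b elements have been inserted in the present block:
--   u, v   with u + v = i; inside a part, v elements of it have been inserted
--          (during an insertion, u already excludes the present element);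
--   r, q   with r + q = N, of which q have been merged with the new elements;
--   c, d   with c + d = b.
Label : Set
Label = Fin 28

#u #v #r #q #c #d : Fin 6
#u = # 0
#v = # 1
#r = # 2
#q = # 3
#c = # 4
#d = # 5

enter first blockStart inBlock part merge old old′ new new′ refill refill′ guess
  guess′ guess″ insert insert′ restore restore′ collect₁ collect₁′ collect₂
  collect₂′ collect₃ collect₃′ nextSize accept reject : Label
enter      = # 0
first      = # 1
blockStart = # 2
inBlock    = # 3
part       = # 4
merge      = # 5
old        = # 6
old′       = # 7
new        = # 8
new′       = # 9
refill     = # 10
refill′    = # 11
guess      = # 12
guess′     = # 13
guess″     = # 14
insert     = # 15
insert′    = # 16
restore    = # 17
restore′   = # 18
collect₁   = # 19
collect₁′  = # 20
collect₂   = # 21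
collect₂′  = # 22
collect₃   = # 23
collect₃′  = # 24
nextSize   = # 25
accept     = # 26
reject     = # 27

-- The next label for an input symbol, given the label for the end of the input.
dispatch : Label → InputSymbol → Label
dispatch l ⊢           = reject
dispatch l (bit false) = collect₁
dispatch l (bit true)  = part
dispatch l ⊣           = l

-- The rows are in the order of the labels.
program : Label → Instruction 6 28
program = lookup
  ( read (λ _ → first)
  ∷ inc #u blockStart
  ∷ read (dispatch accept)
  ∷ read (dispatch reject)
  -- A symbol 1: insert i elements, u of which remain.  Before each of them,
  -- any number of old elements may come in the merged order.
  ∷ dec #u merge restore
  ∷ choose new old (λ ())
  ∷ dec #r old′ reject
  ∷ inc #q merge
  -- Unless the element is the first one of its part, guess one of b values: set
  -- c to b, and stop after decrementing c at least once.
  ∷ dec #v new′ insert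
  ∷ inc #v refill
  ∷ dec #d refill′ guess
  ∷ inc #c refill
  ∷ dec #c guess′ reject
  ∷ inc #d guess″
  ∷ choose insert guess (λ ())
  ∷ inc #c insert′
  ∷ inc #v part
  -- The part is complete: set u to i again.
  ∷ dec #v restore′ inBlock
  ∷ inc #u restore
  -- A symbol 0: all elements become old, and i increases.
  ∷ dec #q collect₁′ collect₂
  ∷ inc #r collect₁
  ∷ dec #c collect₂′ collect₃
  ∷ inc #r collect₂
  ∷ dec #d collect₃′ nextSize
  ∷ inc #r collect₃
  ∷ inc #u blockStart
  ∷ stop true
  ∷ stop false
  ∷ [])

open Compile program enter

-- The number of choices for an element when v elements of its part and b
-- elements of its block have been inserted before.
choices : ℕ → ℕ → ℕ
choices zero    b = 1
choices (suc v) b = b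

-- The product of these numbers for the next t elements of a part.
partChoices : ℕ → ℕ → ℕ → ℕ
partChoices v b zero    = 1
partChoices v b (suc t) = choices v b * partChoices (suc v) (suc b) t

-- The number of elements in the remainder of a block of parts of size i.
blockRest : ℕ → Str → ℕ
blockRest i []          = 0
blockRest i (false ∷ y) = 0
blockRest i (true ∷ y)  = i + blockRest i y

-- The number of accepting paths on the remaining input y, not counting the
-- choices made while merging in the present block; N and b are the numbers of
-- old and of new elements.  The flag e tells whether the input may end here, that
-- is, whether the last symbol was not a 1.
weight : Bool → ℕ → ℕ → ℕ → Str → ℕ
weight e i N b []          = if e then 1 else 0
weight e i N b (false ∷ y) =
  weight true (suc i) (N + b) 0 y *
  ((N + b + blockRest (suc i) y) C blockRest (suc i) y)
weight e i N b (true ∷ y)  = partChoices 0 b i * weight false i N (i + b) y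

module _ (W : ℕ) (x : Str) (B : ℕ) (B<2^W : B < 2 ^ W) where
  open Execution W x

  bounded : ∀ {n} → n ≤ B → n < 2 ^ W
  bounded n≤B = ≤-<-trans n≤B B<2^W

  -- A loop that empties the counter A into A′; s a a′ are the counter values
  -- when A and A′ hold a and a′.
  transfer : ∀ {l l′ m p A A′ n} → program l ≡ dec A l′ m → program l′ ≡ inc A′ l →
    (s : ℕ → ℕ → Vec ℕ 6) →
    (∀ a a′ → lookup (s a a′) A ≡ a) → (∀ a a′ → lookup (s a a′) A′ ≡ a′) →
    (∀ a a′ → s (suc a) a′ [ A ]≔ a ≡ s a a′) →
    (∀ a a′ → s a a′ [ A′ ]≔ suc a′ ≡ s a (suc a′)) →
    ∀ a a′ → a + a′ ≤ B → Accepts m p (s 0 (a + a′)) n → Accepts l p (s a a′) n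
  transfer e e′ s get get′ set set′ zero a′ bd h = accepts-dec-zero e (get 0 a′) h
  transfer {m = m} {p} {A} {A′} {n} e e′ s get get′ set set′ (suc a) a′ bd h =
    accepts-dec e (get (suc a) a′) (subst (λ w → Accepts _ p w n) (sym (set a a′))
      (accepts-inc e′ (bounded (subst (λ k → suc k ≤ B) (sym (get′ a a′))
                                 (≤-trans (s≤s (m≤n+m a′ a)) bd)))
        (subst (λ w → Accepts _ p w n)
          (sym (trans (cong (λ k → s a a′ [ A′ ]≔ suc k) (get′ a a′)) (set′ a a′)))
          (transfer e e′ s get get′ set set′ a (suc a′) (subst (_≤ B) (sym (+-suc a a′)) bd)
            (subst (λ k → Accepts m p (s 0 k) n) (sym (+-suc a a′)) h)))))

  -- The hypothesis counts the paths from the next insertion on, after which k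
  -- more insertions follow in the block.  Each step of the loop is an instance of
  -- Pascal's rule.
  merge-accepts : ∀ {p t v c d N} w k → N ≤ B →
    (∀ r q → r + q ≡ N → Accepts new p (t ∷ v ∷ r ∷ q ∷ c ∷ d ∷ []) (w * ((r + k) C k))) →
    ∀ r q → r + q ≡ N →
    Accepts merge p (t ∷ v ∷ r ∷ q ∷ c ∷ d ∷ []) (w * ((r + suc k) C suc k))
  merge-accepts {p} {N = N} w k N≤B h zero q r+q =
    subst (Accepts merge p _)
      (trans (+-identityʳ _) (cong (w *_) (trans (nCn≡1 k) (sym (nCn≡1 (suc k))))))
      (accepts-choose refl (h 0 q r+q) (accepts-dec-zero refl refl (accepts-stop false refl)))
  merge-accepts {p} {N = N} w k N≤B h (suc r) q r+q =
    subst (Accepts merge p _) pascal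
      (accepts-choose refl (h (suc r) q r+q)
        (accepts-dec refl refl
          (accepts-inc refl (bounded (≤-trans (≤-trans (s≤s (m≤n+m q r)) (≤-reflexive r+q)) N≤B))
            (merge-accepts w k N≤B h r (suc q) (trans (+-suc r q) r+q)))))
    where
    pascal : w * ((suc r + k) C k) + w * ((r + suc k) C suc k) ≡ w * ((suc r + suc k) C suc k)
    pascal = begin
      w * ((suc r + k) C k) + w * ((r + suc k) C suc k)
        ≡⟨ *-distribˡ-+ w _ _ ⟨
      w * ((suc r + k) C k + (r + suc k) C suc k)
        ≡⟨ cong (λ n → w * (n C k + (r + suc k) C suc k)) (+-suc r k) ⟨
      w * ((r + suc k) C k + (r + suc k) C suc k)
        ≡⟨ cong (w *_) (nCk+nC[k+1]≡[n+1]C[k+1] (r + suc k) k) ⟩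
      w * ((suc r + suc k) C suc k) ∎
      where open ≡-Reasoning

  -- The loop may be left after each of its c decrements.
  guess-accepts : ∀ {p t v r q b n} → b ≤ B →
    (∀ c d → c + d ≡ b → Accepts insert p (t ∷ v ∷ r ∷ q ∷ c ∷ d ∷ []) n) →
    ∀ c d → c + d ≡ b → Accepts guess p (t ∷ v ∷ r ∷ q ∷ c ∷ d ∷ []) (c * n)
  guess-accepts b≤B h zero d c+d = accepts-dec-zero refl refl (accepts-stop false refl)
  guess-accepts b≤B h (suc c) d c+d =
    accepts-dec refl refl
      (accepts-inc refl (bounded (≤-trans (≤-trans (s≤s (m≤n+m d c)) (≤-reflexive c+d)) b≤B))
        (accepts-choose refl (h c (suc d) c+1+d) (guess-accepts b≤B h c (suc d) c+1+d)))
    where c+1+d = trans (+-suc c d) c+d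

  new-accepts : ∀ {p t r q b n} v → v ≤ B → b ≤ B →
    (∀ c d → c + d ≡ b → Accepts insert p (t ∷ v ∷ r ∷ q ∷ c ∷ d ∷ []) n) →
    ∀ c d → c + d ≡ b → Accepts new p (t ∷ v ∷ r ∷ q ∷ c ∷ d ∷ []) (choices v b * n)
  new-accepts {p} zero v≤B b≤B h c d c+d =
    subst (Accepts new p _) (sym (+-identityʳ _)) (accepts-dec-zero refl refl (h c d c+d))
  new-accepts {p} {t} {r} {q} {b} {n} (suc v) v≤B b≤B h c d c+d =
    accepts-dec refl refl (accepts-inc refl (bounded v≤B)
      (transfer refl refl (λ d c → t ∷ suc v ∷ r ∷ q ∷ c ∷ d ∷ [])
        (λ _ _ → refl) (λ _ _ → refl) (λ _ _ → refl) (λ _ _ → refl) d c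
        (subst (_≤ B) (sym d+c) b≤B)
        (subst (λ k → Accepts guess p (t ∷ suc v ∷ r ∷ q ∷ k ∷ 0 ∷ []) (b * n)) (sym d+c)
          (guess-accepts b≤B h b 0 (+-identityʳ b)))))
    where d+c = trans (+-comm d c) c+d

  -- Insertion of the t missing elements of a part; k elements of later parts of
  -- the block will follow.
  part-accepts : ∀ {p N w k} t v b → t + v ≤ B → N ≤ B → t + b ≤ B →
    (∀ r q c d → r + q ≡ N → c + d ≡ t + b →
      Accepts restore p (0 ∷ t + v ∷ r ∷ q ∷ c ∷ d ∷ []) (w * ((r + k) C k))) →
    ∀ r q c d → r + q ≡ N → c + d ≡ b →
    Accepts part p (t ∷ v ∷ r ∷ q ∷ c ∷ d ∷ [])
      (partChoices v b t * w * ((r + (t + k)) C (t + k)))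
  part-accepts {p} {w = w} {k} zero v b t+v N≤B t+b h r q c d r+q c+d =
    subst (λ w → Accepts part p _ (w * ((r + k) C k))) (sym (+-identityʳ w))
      (accepts-dec-zero refl refl (h r q c d r+q c+d))
  part-accepts {p} {N} {w} {k} (suc t) v b t+v N≤B t+b h r q c d r+q c+d =
    accepts-dec refl refl
      (merge-accepts (partChoices v b (suc t) * w) (t + k) N≤B
        (λ r q r+q → subst (Accepts new p _) (product r)
          (new-accepts v (≤-trans (m≤n+m v (suc t)) t+v) (≤-trans (m≤n+m b (suc t)) t+b)
            (λ c d c+d →
              accepts-inc refl (bounded (≤-trans (s≤s (≤-trans (m≤m+n c d) (≤-reflexive c+d)))
                                          (≤-trans (s≤s (m≤n+m b t)) t+b)))
              (accepts-inc refl (bounded (≤-trans (s≤s (m≤n+m v t)) t+v))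
                (part-accepts t (suc v) (suc b)
                  (subst (_≤ B) (sym (+-suc t v)) t+v) N≤B
                  (subst (_≤ B) (sym (+-suc t b)) t+b)
                  (λ r q c d r+q c+d →
                    subst (λ k′ → Accepts restore p (0 ∷ k′ ∷ r ∷ q ∷ c ∷ d ∷ [])
                                    (w * ((r + k) C k)))
                      (sym (+-suc t v)) (h r q c d r+q (trans c+d (+-suc t b))))
                  r q (suc c) d r+q (cong suc c+d))))
            c d c+d))
        r q r+q)
    where
    product : ∀ r → choices v b * (partChoices (suc v) (suc b) t * w * ((r + (t + k)) C (t + k))) ≡
                    partChoices v b (suc t) * w * ((r + (t + k)) C (t + k))
    product r = lemma (choices v b) (partChoices (suc v) (suc b) t) w _
      where
      lemma : ∀ m n o p → m * (n * o * p) ≡ m * n * o * p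
      lemma = solve-∀

  -- The input position p is that of the first symbol of the suffix y of x.
  Suffix : ℕ → Str → Set
  Suffix p y = ∃[ pre ] (x ≡ pre ++ y × p ≡ suc (length pre))

  suffix-[] : ∀ {p} → Suffix p [] → readInput x p ≡ ⊣
  suffix-[] (pre , refl , refl) = go pre
    where
    go : ∀ pre → readInput (pre ++ []) (suc (length pre)) ≡ ⊣
    go []        = refl
    go (_ ∷ pre) = go pre

  suffix-∷ : ∀ {p a y} → Suffix p (a ∷ y) → readInput x p ≡ bit a
  suffix-∷ {a = a} {y} (pre , refl , refl) = go pre
    where
    go : ∀ pre → readInput (pre ++ a ∷ y) (suc (length pre)) ≡ bit a
    go []        = refl
    go (_ ∷ pre) = go pre

  suffix-tail : ∀ {p a y} → Suffix p (a ∷ y) → Suffix (moveInput x right p) y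
  suffix-tail {a = a} {y} (pre , refl , refl) =
    pre ++ a ∷ [] , sym (++-assoc pre (a ∷ []) y) , cong suc (begin
      suc (length pre) ⊓ length (pre ++ a ∷ y)
        ≡⟨ m≤n⇒m⊓n≡m (subst (suc (length pre) ≤_) (sym (length-++ pre))
             (subst (_≤ length pre + suc (length y)) (+-comm (length pre) 1)
               (+-monoʳ-≤ (length pre) (s≤s z≤n)))) ⟩
      suc (length pre)            ≡⟨ +-comm 1 (length pre) ⟩
      length pre + 1              ≡⟨ length-++ pre ⟨
      length (pre ++ a ∷ [])      ∎)
    where open ≡-Reasoning

  -- The labels for reading a symbol and for the end of the input, given whether
  -- the input may end here.
  nextSymbol : Bool → Label
  nextSymbol true  = blockStart
  nextSymbol false = inBlock

  atEnd : Bool → Label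
  atEnd true  = accept
  atEnd false = reject

  accepts-dispatch : ∀ {p s vs n} e → readInput x p ≡ s →
    Accepts (dispatch (atEnd e) s) (moveInput x right p) vs n →
    Accepts (nextSymbol e) p vs n
  accepts-dispatch true  refl h = accepts-read refl h
  accepts-dispatch false refl h = accepts-read refl h

  -- M bounds every part size, so that each symbol 1 adds at most M elements.
  input-accepts : ∀ M → M ≤ B → ∀ e y {p} i b N → Suffix p y →
    i + length y ≤ M → N + b + length y * M ≤ B →
    ∀ r q c d → r + q ≡ N → c + d ≡ b →
    Accepts (nextSymbol e) p (i ∷ 0 ∷ r ∷ q ∷ c ∷ d ∷ [])
      (weight e i N b y * ((r + blockRest i y) C blockRest i y))
  input-accepts M M≤B e [] {p} i b N suf _ _ r q c d _ _ =
    subst (Accepts (nextSymbol e) p _) (sym (*-identityʳ _))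
      (accepts-dispatch e (suffix-[] suf) (finish e))
    where
    finish : ∀ {p vs} e → Accepts (atEnd e) p vs (if e then 1 else 0)
    finish true  = accepts-stop true refl
    finish false = accepts-stop false refl
  input-accepts M M≤B e (false ∷ y) {p} i b N suf i≤M bd r q c d refl refl =
    subst (Accepts (nextSymbol e) p _) (sym (*-identityʳ _))
      (accepts-dispatch e (suffix-∷ suf)
        (transfer refl refl (λ q r → i ∷ 0 ∷ r ∷ q ∷ c ∷ d ∷ [])
          (λ _ _ → refl) (λ _ _ → refl) (λ _ _ → refl) (λ _ _ → refl) q r
          (≤-trans (m≤n+m (q + r) (d + c)) (≤-trans (≤-reflexive (+-assoc d c (q + r))) sum≤B))
        (transfer refl refl (λ c r → i ∷ 0 ∷ r ∷ 0 ∷ c ∷ d ∷ [])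
          (λ _ _ → refl) (λ _ _ → refl) (λ _ _ → refl) (λ _ _ → refl) c (q + r)
          (≤-trans (m≤n+m _ d) sum≤B)
        (transfer refl refl (λ d r → i ∷ 0 ∷ r ∷ 0 ∷ 0 ∷ d ∷ [])
          (λ _ _ → refl) (λ _ _ → refl) (λ _ _ → refl) (λ _ _ → refl) d (c + (q + r)) sum≤B
        (subst (λ k → Accepts nextSize (moveInput x right p) (i ∷ 0 ∷ k ∷ 0 ∷ 0 ∷ 0 ∷ []) n) (sym sum-total)
          (accepts-inc refl (bounded (≤-trans (≤-trans (m≤m+n (suc i) (length y)) i<M) M≤B))
            (input-accepts M M≤B true y (suc i) 0 total (suffix-tail suf) i<M new-bound
              total 0 0 0 (+-identityʳ total) refl)))))))
    where
    total = r + q + (c + d)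
    n = weight true (suc i) total 0 y * ((total + blockRest (suc i) y) C blockRest (suc i) y)
    sum-total : d + (c + (q + r)) ≡ total
    sum-total = lemma r q c d
      where
      lemma : ∀ r q c d → d + (c + (q + r)) ≡ r + q + (c + d)
      lemma = solve-∀
    sum≤B : d + (c + (q + r)) ≤ B
    sum≤B = subst (_≤ B) (sym sum-total) (≤-trans (m≤m+n total _) bd)
    new-bound : total + 0 + length y * M ≤ B
    new-bound = ≤-trans (+-mono-≤ (≤-reflexive (+-identityʳ total)) (m≤n+m _ M)) bd
    i<M : suc i + length y ≤ M
    i<M = subst (_≤ M) (+-suc i (length y)) i≤M
  input-accepts M M≤B e (true ∷ y) {p} i b N suf i≤M bd r q c d r+q c+d =
    accepts-dispatch e (suffix-∷ suf)
      (part-accepts i 0 b i+0≤B N≤B i+b≤B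
        (λ r q c d r+q c+d →
          transfer refl refl (λ v u → u ∷ v ∷ r ∷ q ∷ c ∷ d ∷ [])
            (λ _ _ → refl) (λ _ _ → refl) (λ _ _ → refl) (λ _ _ → refl) (i + 0) 0
            (subst (_≤ B) (sym (+-identityʳ (i + 0))) i+0≤B)
            (subst (λ k → Accepts inBlock (moveInput x right p) (k ∷ 0 ∷ r ∷ q ∷ c ∷ d ∷ [])
                     (weight false i N (i + b) y * ((r + blockRest i y) C blockRest i y)))
              (sym (trans (+-identityʳ (i + 0)) (+-identityʳ i)))
              (input-accepts M M≤B false y i (i + b) N (suffix-tail suf) i+y≤M new-bound
                r q c d r+q c+d)))
        r q c d r+q c+d)
    where
    i≤M′ : i ≤ M
    i≤M′ = ≤-trans (m≤m+n i _) i≤M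
    i+0≤B : i + 0 ≤ B
    i+0≤B = subst (_≤ B) (sym (+-identityʳ i)) (≤-trans i≤M′ M≤B)
    i+y≤M : i + length y ≤ M
    i+y≤M = ≤-trans (+-monoʳ-≤ i (n≤1+n _)) i≤M
    new-bound : N + (i + b) + length y * M ≤ B
    new-bound = ≤-trans (+-monoˡ-≤ (length y * M) (+-monoʳ-≤ N (+-monoˡ-≤ b i≤M′)))
                  (≤-trans (≤-reflexive (lemma N M b (length y * M))) bd)
      where
      lemma : ∀ n m b k → n + (m + b) + k ≡ n + b + (m + k)
      lemma = solve-∀
    N≤B : N ≤ B
    N≤B = ≤-trans (≤-trans (m≤m+n N b) (m≤m+n (N + b) _)) bd
    i+b≤B : i + b ≤ B
    i+b≤B = ≤-trans (≤-trans (m≤n+m (i + b) N) (m≤m+n (N + (i + b)) _)) new-bound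

-- Counting the accepting paths

partChoices-later : ∀ v b t → partChoices (suc v) (suc b) t * b ! ≡ (t + b) !
partChoices-later v b zero    = +-identityʳ (b !)
partChoices-later v b (suc t) = begin
  suc b * partChoices (suc (suc v)) (suc (suc b)) t * b !
    ≡⟨ lemma (suc b) (partChoices (suc (suc v)) (suc (suc b)) t) (b !) ⟩
  partChoices (suc (suc v)) (suc (suc b)) t * suc b !
    ≡⟨ partChoices-later (suc v) (suc b) t ⟩
  (t + suc b) !
    ≡⟨ cong _! (+-suc t b) ⟩
  (suc t + b) ! ∎
  where
  open ≡-Reasoning
  lemma : ∀ m n o → m * n * o ≡ n * (m * o)
  lemma = solve-∀

partChoices-product : ∀ b i → partChoices 0 b (suc i) * b ! ≡ (i + b) !
partChoices-product b i =
  trans (cong (_* b !) (+-identityʳ (partChoices 1 (suc b) i))) (partChoices-later 0 b i)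

binomial-factorials : ∀ n k → ((n + k) C k) * (n ! * k !) ≡ (n + k) !
binomial-factorials n k = begin
  ((n + k) C k) * (n ! * k !)
    ≡⟨ cong (((n + k) C k) *_) (trans (*-comm (n !) (k !)) (cong (λ j → k ! * j !) (sym (m+n∸n≡m n k)))) ⟩
  ((n + k) C k) * (k ! * (n + k ∸ k) !)
    ≡⟨ cong (_* (k ! * (n + k ∸ k) !)) (nCk≡n!/k![n-k]! (m≤n+m k n)) ⟩
  (n + k) ! / (k ! * (n + k ∸ k) !) * (k ! * (n + k ∸ k) !)
    ≡⟨ m/n*n≡m (k![n∸k]!∣n! (m≤n+m k n)) ⟩
  (n + k) ! ∎
  where
  open ≡-Reasoning
  instance _ = k !* (n + k ∸ k) !≢0

-- The number of accepting paths from the start of a block of parts of size i,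
-- when N elements lie in smaller parts.
blockPaths : ℕ → ℕ → Str → ℕ
blockPaths i N y = weight true i N 0 y * ((N + blockRest i y) C blockRest i y)

blockRest-ones : ∀ i m y → blockRest i (replicate m true ++ false ∷ y) ≡ m * i
blockRest-ones i zero    y = refl
blockRest-ones i (suc m) y = cong (i +_) (blockRest-ones i m y)

-- When j parts of the block are complete and m are missing.
weight-ones : ∀ e i N j m y → let s = suc i in
  weight e s N (j * s) (replicate m true ++ false ∷ y) * (j * s) ! * (s ^ m * (m + j) !) ≡
  j ! * (((m + j) * s) ! * blockPaths (suc s) (N + (m + j) * s) y)
weight-ones e i N j zero y =
  lemma (blockPaths (suc (suc i)) (N + j * suc i) y) ((j * suc i) !) (j !)
  where
  lemma : ∀ m n o → m * n * (1 * o) ≡ o * (n * m)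
  lemma = solve-∀
weight-ones e i N j (suc m) y = *-cancelˡ-≡ _ _ (suc j) (begin
  suc j * (P * w * b ! * (s * s ^ m * (suc m + j) !))
    ≡⟨ lemma (suc j) P w (b !) s (s ^ m) ((suc m + j) !) ⟩
  w * (suc j * s * (P * b !)) * (s ^ m * (suc m + j) !)
    ≡⟨ cong (λ f → w * (suc j * s * f) * (s ^ m * (suc m + j) !)) (partChoices-product b i) ⟩
  w * (suc j * s) ! * (s ^ m * (suc m + j) !)
    ≡⟨ cong (λ n → w * (suc j * s) ! * (s ^ m * n !)) (+-suc m j) ⟨
  w * (suc j * s) ! * (s ^ m * (m + suc j) !)
    ≡⟨ weight-ones false i N (suc j) m y ⟩
  suc j ! * (((m + suc j) * s) ! * blockPaths (suc s) (N + (m + suc j) * s) y)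
    ≡⟨ cong (λ n → suc j ! * ((n * s) ! * blockPaths (suc s) (N + n * s) y)) (+-suc m j) ⟩
  suc j ! * (((suc m + j) * s) ! * blockPaths (suc s) (N + (suc m + j) * s) y)
    ≡⟨ *-assoc (suc j) (j !) _ ⟩
  suc j * (j ! * (((suc m + j) * s) ! * blockPaths (suc s) (N + (suc m + j) * s) y)) ∎)
  where
  open ≡-Reasoning
  s = suc i
  b = j * s
  P = partChoices 0 b s
  w = weight false s N (s + b) (replicate m true ++ false ∷ y)
  lemma : ∀ j p w b s t n → j * (p * w * b * (s * t * n)) ≡ w * (j * s * (p * b)) * (t * n)
  lemma = solve-∀

blockPaths-encode : ∀ i N α →
  blockPaths (suc i) N (encode α) * (N ! * zFrom i α) ≡ (N + sizeFrom i α) !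
blockPaths-encode i N [] = begin
  1 * ((N + 0) C 0) * (N ! * 1) ≡⟨ cong (_* (N ! * 1)) (*-identityˡ ((N + 0) C 0)) ⟩
  ((N + 0) C 0) * (N ! * 1)     ≡⟨ binomial-factorials N 0 ⟩
  (N + 0) !                     ∎
  where open ≡-Reasoning
blockPaths-encode i N (m ∷ ms) = begin
  w * ((N + blockRest s x) C blockRest s x) * (N ! * (s ^ m * m ! * z′))
    ≡⟨ cong (λ k → w * ((N + k) C k) * (N ! * (s ^ m * m ! * z′))) (blockRest-ones s m (encode ms)) ⟩
  w * ((N + m * s) C (m * s)) * (N ! * (s ^ m * m ! * z′))
    ≡⟨ lemma₁ w ((N + m * s) C (m * s)) (N !) (s ^ m * m !) z′ ⟩
  w * (s ^ m * m !) * ((N + m * s) C (m * s)) * (N ! * z′)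
    ≡⟨ cong (λ k → k * ((N + m * s) C (m * s)) * (N ! * z′)) block ⟩
  (m * s) ! * rest * ((N + m * s) C (m * s)) * (N ! * z′)
    ≡⟨ lemma₂ ((m * s) !) rest ((N + m * s) C (m * s)) (N !) z′ ⟩
  rest * (((N + m * s) C (m * s)) * (N ! * (m * s) !) * z′)
    ≡⟨ cong (λ k → rest * (k * z′)) (binomial-factorials N (m * s)) ⟩
  rest * ((N + m * s) ! * z′)
    ≡⟨ blockPaths-encode s (N + m * s) ms ⟩
  (N + m * s + sizeFrom s ms) !
    ≡⟨ cong _! (trans (+-assoc N (m * s) _) (cong (λ k → N + (k + sizeFrom s ms)) (*-comm m s))) ⟩
  (N + (s * m + sizeFrom s ms)) ! ∎
  where
  open ≡-Reasoning
  s = suc i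
  x = encode (m ∷ ms)
  w = weight true s N 0 x
  z′ = zFrom s ms
  rest = blockPaths (suc s) (N + m * s) (encode ms)
  block : w * (s ^ m * m !) ≡ (m * s) ! * rest
  block = begin
    w * (s ^ m * m !)
      ≡⟨ cong₂ (λ k n → k * (s ^ m * n !)) (sym (*-identityʳ w)) (sym (+-identityʳ m)) ⟩
    w * 1 * (s ^ m * (m + 0) !)
      ≡⟨ weight-ones true i N 0 m (encode ms) ⟩
    1 * (((m + 0) * s) ! * blockPaths (suc s) (N + (m + 0) * s) (encode ms))
      ≡⟨ *-identityˡ _ ⟩
    ((m + 0) * s) ! * blockPaths (suc s) (N + (m + 0) * s) (encode ms)
      ≡⟨ cong (λ n → (n * s) ! * blockPaths (suc s) (N + n * s) (encode ms)) (+-identityʳ m) ⟩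
    (m * s) ! * rest ∎
  lemma₁ : ∀ w c n k z → w * c * (n * (k * z)) ≡ w * k * c * (n * z)
  lemma₁ = solve-∀
  lemma₂ : ∀ f r c n z → f * r * c * (n * z) ≡ r * (c * (n * f) * z)
  lemma₂ = solve-∀

-- A string that is not an encoding ends with a 1, and is rejected.
weight-undecodable : ∀ e i N b y → decode (if e then y else true ∷ y) ≡ nothing →
                     weight e i N b y ≡ 0
weight-undecodable true  i N b []          ()
weight-undecodable false i N b []          _  = refl
weight-undecodable e     i N b (false ∷ y) eq =
  cong (_* ((N + b + blockRest (suc i) y) C blockRest (suc i) y))
    (weight-undecodable true (suc i) (N + b) 0 y (decode-rest e eq))
  where
  decode-rest : ∀ e → decode (if e then false ∷ y else true ∷ false ∷ y) ≡ nothing →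
                decode y ≡ nothing
  decode-rest true  eq with decode y
  decode-rest true  () | just _
  decode-rest true  eq | nothing = refl
  decode-rest false eq with decode y
  decode-rest false () | just _
  decode-rest false eq | nothing = refl
weight-undecodable e     i N b (true ∷ y)  eq =
  trans (cong (partChoices 0 b i *_)
          (weight-undecodable false i N (i + b) y (decode-rest e eq)))
        (*-zeroʳ (partChoices 0 b i))
  where
  decode-rest : ∀ e → decode (if e then true ∷ y else true ∷ true ∷ y) ≡ nothing →
                decode (true ∷ y) ≡ nothing
  decode-rest true  eq = eq
  decode-rest false eq with decode y
  decode-rest false () | just (_ ∷ _)
  decode-rest false eq | just []  = refl
  decode-rest false eq | nothing  = refl

blockPaths-count : ∀ x → blockPaths 1 0 x ≡ cycleTypeFunction x
blockPaths-count x with decode x in eq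
... | nothing = cong (_* (blockRest 1 x C blockRest 1 x)) (weight-undecodable true 1 0 0 x eq)
... | just α  = begin
  blockPaths 1 0 x                         ≡⟨ cong (blockPaths 1 0) (encode-decode x eq) ⟨
  blockPaths 1 0 (encode α)                ≡⟨ m*n/n≡m _ (z α) ⟨
  blockPaths 1 0 (encode α) * z α / z α    ≡⟨ /-congˡ product ⟩
  size α ! / z α                           ∎
  where
  open ≡-Reasoning
  instance _ = zFrom≢0 0 α
  product : blockPaths 1 0 (encode α) * z α ≡ size α !
  product = trans (cong (blockPaths 1 0 (encode α) *_) (sym (*-identityˡ (z α))))
                  (blockPaths-encode 0 0 α)

n<2^[1+⌊log₂n⌋] : ∀ n → n < 2 ^ suc ⌊log₂ n ⌋
n<2^[1+⌊log₂n⌋] n = ≰⇒> λ 2^k≤n →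
  n≮n ⌊log₂ n ⌋ (subst (_≤ ⌊log₂ n ⌋) (⌊log₂[2^n]⌋≡n (suc ⌊log₂ n ⌋)) (⌊log₂⌋-mono-≤ 2^k≤n))

module _ (x : Str) where
  private
    s = suc ⌊log₂ length x ⌋
    -- No counter exceeds M * M: every part size is at most M, and each of the
    -- fewer than M symbols 1 adds the elements of one part.
    M = suc (length x)
    W = suc (s + s)

    M*M<2^W : M * M < 2 ^ W
    M*M<2^W = ≤-<-trans
      (subst (M * M ≤_) (sym (^-distribˡ-+-* 2 s s))
        (*-mono-≤ (n<2^[1+⌊log₂n⌋] (length x)) (n<2^[1+⌊log₂n⌋] (length x))))
      (^-monoʳ-< 2 (s≤s (s≤s z≤n)) (n<1+n (s + s)))

  open Execution W x using (S; Accepts; accepts-read; accepts-inc; initial-counters)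

  computation-tree : Computation.Tree machine x S (Run.initial machine x) (cycleTypeFunction x)
  computation-tree = Accepts.computation enter-accepts _ initial-counters
    where
    enter-accepts : Accepts enter 0 (Vec.replicate 6 0) (cycleTypeFunction x)
    enter-accepts = accepts-read refl (accepts-inc refl
      (≤-<-trans (s≤s z≤n) M*M<2^W)
      (subst (Accepts blockStart 1 _) (blockPaths-count x)
        (input-accepts W x (M * M) M*M<2^W M (m≤m*n M M) true x 1 0 0
          ([] , refl , refl) ≤-refl (*-monoˡ-≤ M (n≤1+n (length x)))
          0 0 0 0 refl refl)))

  S≤ : S ≤ 36 * s
  S≤ = begin
    6 * (3 + suc (s + s))      ≡⟨ lemma ⌊log₂ length x ⌋ ⟩
    36 + 12 * ⌊log₂ length x ⌋ ≤⟨ +-monoʳ-≤ 36 (*-monoˡ-≤ ⌊log₂ length x ⌋ (m≤m+n 12 24)) ⟩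
    36 + 36 * ⌊log₂ length x ⌋ ≡⟨ *-suc 36 ⌊log₂ length x ⌋ ⟨
    36 * s                     ∎
    where
    open ≤-Reasoning
    lemma : ∀ l → 6 * (3 + suc (suc l + suc l)) ≡ 36 + 12 * l
    lemma = solve-∀

theorem3p23 : cycleTypeFunction ∈#L
theorem3p23 = machine ,
  (36 , λ x c reachable → ≤-trans (tree-space machine x (computation-tree x) reachable) (S≤ x)) ,
  (λ x → tree-halts machine x (computation-tree x)) ,
  (λ x → tree-paths machine x (computation-tree x))
  where open Computation
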